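{- Let $B_1$ and $B_2$ be rook equivalent Ferrers boards, both written with $n$ columns, such that $\{B_1,B_2\}$ is an edge of the rook equivalence graph. Then the root vectors $\xi(B_1)$ and $\xi(B_2)$ differ only in two positions, whose entries are swapped. That is, if $\xi(B_1)=\langle z_1,\ldots,z_{i_1},\ldots,z_{i_2},\ldots,z_n\rangle$ then $\xi(B_2)=\langle z_1,\ldots,z_{i_2},\ldots,z_{i_1},\ldots,z_n\rangle$ for some $1\le i_1<i_2\le n$ with $z_{i_1}\neq z_{i_2}$.
   Context: A Ferrers board is given by a weakly increasing sequence of non-negative integers $B=(b_1,\ldots,b_n)$ of column heights; it is the set of unit cells in the first quadrant lying in column $i$ and rows $1,\ldots,b_i$. Prepending columns of height $0$ on the left does not change the board, and boards are compared using the same number of columns by such padding. A placement of $k$ rooks on $B$ is a set of $k$ cells of $B$ no two in the same row or column; $r_k(B)$ is the number of such placements. Two boards are rook equivalent ($B_1\equiv B_2$) if $r_k(B_1)=r_k(B_2)$ for all $k\ge 0$. The root vector of $B=(b_1,\ldots,b_n)$ is $\xi(B)=\langle 0-b_1,1-b_2,\ldots,(n-1)-b_n\rangle$. The rook equivalence graph of the class of $B$ has as vertices all Ferrers boards rook equivalent to $B$, and $\{B_1,B_2\}$ is an edge iff, written with the same number of columns, $B_1$ and $B_2$ differ in exactly two columns $i$ and $j$, where $B_1$ has $k$ more cells than $B_2$ in column $i$ and $k$ fewer cells than $B_2$ in column $j$, for some $k>0$ (i.e. one is obtained from the other by moving $k$ cells from the top of one column to the top of another). -}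

module Defs where

open import Data.Fin as Fin using (Fin; toℕ)
import Data.Fin.Properties as Fin
open import Data.Integer as ℤ using (ℤ; +_)
open import Data.List using (List; []; _∷_; _++_; map; concatMap; allFin; upTo; filter; length)
open import Data.List.Relation.Unary.AllPairs using (allPairs?)
open import Data.Nat as ℕ using (ℕ; zero; suc; _+_; _≤_; _<_)
open import Data.Product using (∃-syntax; _×_; _,_; proj₁; proj₂)
open import Data.Vec.Functional using (Vector)
open import Relation.Binary.Definitions using (Decidable)
open import Relation.Binary.PropositionalEquality using (_≡_; _≢_)
open import Relation.Nullary.Decidable using (_×-dec_; ¬?)

record FerrersBoard (n : ℕ) : Set where
  field
    height     : Vector ℕ n
    increasing : ∀ {i j} → i Fin.≤ j → height i ≤ height j

open FerrersBoard public

-- A cell is a (column, row) pair. Both coordinates count from 0, so column i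
-- of a board occupies rows 0, …, height i - 1.
Cell : ℕ → Set
Cell n = Fin n × ℕ

cells : ∀ {n} → FerrersBoard n → List (Cell n)
cells {n} B = concatMap (λ i → map (i ,_) (upTo (height B i))) (allFin n)

NonAttacking : ∀ {n} → Cell n → Cell n → Set
NonAttacking c d = proj₁ c ≢ proj₁ d × proj₂ c ≢ proj₂ d

nonAttacking? : ∀ {n} → Decidable (NonAttacking {n})
nonAttacking? c d = ¬? (proj₁ c Fin.≟ proj₁ d) ×-dec ¬? (proj₂ c ℕ.≟ proj₂ d)

-- The sublists of length k. For a list without repetitions these represent
-- the k-element subsets, each exactly once.
choose : ∀ {a} {A : Set a} → ℕ → List A → List (List A)
choose zero    xs       = [] ∷ []
choose (suc k) []       = []
choose (suc k) (x ∷ xs) = map (x ∷_) (choose k xs) ++ choose (suc k) xs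

-- `cells B` has no repetitions, so every set of k cells is considered once.
placements : ∀ {n} → FerrersBoard n → ℕ → List (List (Cell n))
placements B k = filter (allPairs? nonAttacking?) (choose k (cells B))

rookNumber : ∀ {n} → FerrersBoard n → ℕ → ℕ
rookNumber B k = length (placements B k)

-- The numbers of columns may differ: columns of height 0 contain no cells.
RookEquivalent : ∀ {m n} → FerrersBoard m → FerrersBoard n → Set
RookEquivalent B₁ B₂ = ∀ k → rookNumber B₁ k ≡ rookNumber B₂ k

-- With columns counted from 0, the usual entry (i - 1) - bᵢ becomes i - bᵢ.
rootVector : ∀ {n} → FerrersBoard n → Vector ℤ n
rootVector B i = + toℕ i ℤ.- + height B i

-- The columns i and j are in no particular order, so the relation is symmetric.
DifferByMove : ∀ {n} → FerrersBoard n → FerrersBoard n → Set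
DifferByMove B₁ B₂ = ∃[ i ] ∃[ j ] ∃[ k ]
  i ≢ j × 0 < k ×
  height B₁ i ≡ height B₂ i + k ×
  height B₁ j + k ≡ height B₂ j ×
  (∀ l → l ≢ i → l ≢ j → height B₁ l ≡ height B₂ l)

-- Edges of the rook equivalence graph of the class of B, between boards
-- written with the same number n of columns.
record Edge {m n} (B : FerrersBoard m) (B₁ B₂ : FerrersBoard n) : Set where
  field
    vertex₁ : RookEquivalent B₁ B
    vertex₂ : RookEquivalent B₂ B
    move    : DifferByMove B₁ B₂

DifferBySwap : ∀ {n} → Vector ℤ n → Vector ℤ n → Set
DifferBySwap z w = ∃[ i₁ ] ∃[ i₂ ]
  i₁ Fin.< i₂ × z i₁ ≢ z i₂ ×
  w i₁ ≡ z i₂ × w i₂ ≡ z i₁ ×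
  (∀ l → l ≢ i₁ → l ≢ i₂ → w l ≡ z l)

{-# OPTIONS --safe #-}

-- Only r₂ is needed. For a Ferrers board with columns 0, …, n - 1,
--   2 r₂ + Σᵢ bᵢ (bᵢ + 2 (n - 1 - i)) = (Σᵢ bᵢ)²,
-- and a move preserves Σᵢ bᵢ, so a move between rook equivalent boards also
-- preserves Σᵢ bᵢ (bᵢ + 2 (n - 1 - i)). Only the two columns of the move
-- contribute to the difference; after division by 2k the equality becomes
-- i - b₂ᵢ = j - b₁ⱼ, which says that the two entries are swapped.
module Submission where

open import Defs
open import Data.Fin as Fin using (Fin; zero; suc; toℕ; punchIn)
import Data.Fin.Properties as Fin
open import Data.Integer as ℤ using (ℤ; +_)
import Data.Integer.Properties as ℤ
open import Data.List using (List; []; _∷_; _++_; map; concatMap; tabulate; upTo; filter; length)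
open import Data.List.Membership.Propositional using (_∈_)
open import Data.List.Membership.Propositional.Properties using (∈-upTo⁺)
open import Data.List.Properties
  using (filter-++; filter-none; filter-all; filter-accept; filter-reject; length-++; length-map; length-upTo)
open import Data.List.Relation.Unary.All as All using (All; []; _∷_)
import Data.List.Relation.Unary.All.Properties as All
open import Data.List.Relation.Unary.AllPairs as AllPairs using (AllPairs; []; _∷_; allPairs?)
import Data.List.Relation.Unary.AllPairs.Properties as AllPairs
open import Data.List.Relation.Unary.Any using (here; there)
open import Data.List.Relation.Unary.Unique.Propositional using (Unique)
open import Data.List.Relation.Unary.Unique.Propositional.Properties using (upTo⁺)
open import Data.Nat using (ℕ; zero; suc; pred; NonZero; >-nonZero; z≤n; s≤s; _+_; _*_; _∸_; _≤_; _<_)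
open import Data.Nat.Properties
  using (+-assoc; +-comm; +-identityʳ; +-cancelˡ-≡; +-cancelʳ-≡; *-cancelˡ-≡;
         +-0-commutativeMonoid; m+[n∸m]≡n; m<m+n; <-≤-trans; <⇒≢)
open import Data.Nat.Tactic.RingSolver using (solve-∀)
open import Data.Product using (_,_; proj₁; proj₂)
open import Data.Vec.Functional using (Vector; removeAt; updateAt)
open import Data.Vec.Functional.Properties using (updateAt-updates; updateAt-minimal)
open import Algebra.Properties.CommutativeMonoid.Sum +-0-commutativeMonoid
  using (sum; sum-remove; sum-cong-≗)
open import Algebra.Properties.AbelianGroup ℤ.+-0-abelianGroup using (∙-cancelˡ)
open import Function using (_∘_; const; id)
open import Function.Definitions using (Injective)
open import Relation.Binary.Definitions using (Decidable; tri<; tri≈; tri>)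
open import Relation.Binary.PropositionalEquality hiding (J)
open import Relation.Nullary using (¬_; yes; no; contradiction)
import Relation.Unary as Unary

-- Counting related pairs in a list

module _ {a ℓ} {A : Set a} {R : A → A → Set ℓ} (R? : Decidable R) where

  relatedPairs : List A → ℕ
  relatedPairs []       = 0
  relatedPairs (x ∷ xs) = length (filter (R? x) xs) + relatedPairs xs

  private
    pairsWith : ∀ x xs →
      length (filter (allPairs? R?) (map (x ∷_) (choose 1 xs))) ≡ length (filter (R? x) xs)
    pairsWith x []       = refl
    pairsWith x (y ∷ xs) with R? x y
    ... | yes _ = cong suc (pairsWith x xs)
    ... | no _  = pairsWith x xs

  -- A sublist of length 2 is an entry together with a later one, so the count follows the recursion
  -- of `choose` on the head.
  length-filter-choose₂ : ∀ xs → length (filter (allPairs? R?) (choose 2 xs)) ≡ relatedPairs xs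
  length-filter-choose₂ []       = refl
  length-filter-choose₂ (x ∷ xs) = begin
    length (filter (allPairs? R?) (map (x ∷_) (choose 1 xs) ++ choose 2 xs))
      ≡⟨ cong length (filter-++ (allPairs? R?) (map (x ∷_) (choose 1 xs)) _) ⟩
    length (filter (allPairs? R?) (map (x ∷_) (choose 1 xs)) ++ filter (allPairs? R?) (choose 2 xs))
      ≡⟨ length-++ (filter (allPairs? R?) (map (x ∷_) (choose 1 xs))) ⟩
    length (filter (allPairs? R?) (map (x ∷_) (choose 1 xs))) + length (filter (allPairs? R?) (choose 2 xs))
      ≡⟨ cong₂ _+_ (pairsWith x xs) (length-filter-choose₂ xs) ⟩
    length (filter (R? x) xs) + relatedPairs xs ∎
    where open ≡-Reasoning

  -- Each entry of `xs` contributes only pairs with `ys`, namely `s - m` of them; the additive form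
  -- avoids subtraction. In use, `xs` is one column, `ys` the columns to its right, `m` their number
  -- and `s` their number of cells.
  relatedPairs-++ : ∀ {m s} {xs ys} →
    AllPairs (λ x y → ¬ R x y) xs →
    All (λ x → length (filter (R? x) ys) + m ≡ s) xs →
    relatedPairs (xs ++ ys) + length xs * m ≡ length xs * s + relatedPairs ys
  relatedPairs-++ [] [] = +-identityʳ _
  relatedPairs-++ {m} {s} {x ∷ xs} {ys} (¬xR ∷ ¬R) (x-count ∷ counts) = begin
    length (filter (R? x) (xs ++ ys)) + p + (m + length xs * m)
      ≡⟨ cong (λ zs → length zs + p + (m + length xs * m))
           (trans (filter-++ (R? x) xs ys) (cong (_++ filter (R? x) ys) (filter-none (R? x) ¬xR))) ⟩
    c + p + (m + length xs * m)
      ≡⟨ interchange c p m (length xs * m) ⟩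
    c + m + (p + length xs * m)
      ≡⟨ cong₂ _+_ x-count (relatedPairs-++ ¬R counts) ⟩
    s + (length xs * s + relatedPairs ys)
      ≡⟨ +-assoc s _ _ ⟨
    s + length xs * s + relatedPairs ys ∎
    where
    open ≡-Reasoning
    c = length (filter (R? x) ys)
    p = relatedPairs (xs ++ ys)
    interchange : ∀ c p m q → c + p + (m + q) ≡ c + m + (p + q)
    interchange = solve-∀

-- Without repetitions `x` occurs once, so the filter drops a single entry. In use, the list
-- enumerates the rows of a column and `x` is the row of an attacking rook.
length-filter-map-except : ∀ {a b p} {A : Set a} {B : Set b} {P : B → Set p}
  (P? : Unary.Decidable P) (f : A → B) {x xs} →
  Unique xs → x ∈ xs → ¬ P (f x) → (∀ {y} → y ≢ x → P (f y)) →
  suc (length (filter P? (map f xs))) ≡ length xs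
length-filter-map-except P? f {xs = x ∷ xs} (x∉xs ∷ _) (here refl) ¬Pfx P-else = cong suc (begin
  length (filter P? (f x ∷ map f xs)) ≡⟨ cong length (filter-reject P? ¬Pfx) ⟩
  length (filter P? (map f xs))
    ≡⟨ cong length (filter-all P? (All.map⁺ (All.map (λ x≢y → P-else (x≢y ∘ sym)) x∉xs))) ⟩
  length (map f xs)                   ≡⟨ length-map f xs ⟩
  length xs                           ∎)
  where open ≡-Reasoning
length-filter-map-except P? f (y∉xs ∷ xs!) (there x∈xs) ¬Pfx P-else = cong suc (trans
  (cong length (filter-accept P? (P-else (All.lookup y∉xs x∈xs))))
  (length-filter-map-except P? f xs! x∈xs ¬Pfx P-else))

-- Non-attacking pairs of cells on a Ferrers board

module _ {n} (h : Vector ℕ n) where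

  column : Fin n → List (Cell n)
  column i = map (i ,_) (upTo (h i))

  -- The cell (i, r) attacks exactly one cell of every column of g.
  nonAttackedCells : ∀ {m} (g : Vector (Fin n) m) {i r} →
    (∀ l → i ≢ g l) → (∀ l → r < h (g l)) →
    length (filter (nonAttacking? (i , r)) (concatMap column (tabulate g))) + m ≡ sum (h ∘ g)
  nonAttackedCells {zero}  g i∉g r<h = refl
  nonAttackedCells {suc m} g {i} {r} i∉g r<h = begin
    length (filter NA? (col ++ rest)) + suc m
      ≡⟨ cong (λ zs → length zs + suc m) (filter-++ NA? col rest) ⟩
    length (filter NA? col ++ filter NA? rest) + suc m
      ≡⟨ cong (_+ suc m) (length-++ (filter NA? col)) ⟩
    length (filter NA? col) + length (filter NA? rest) + suc m
      ≡⟨ shift (length (filter NA? col)) _ m ⟩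
    suc (length (filter NA? col)) + (length (filter NA? rest) + m)
      ≡⟨ cong₂ _+_
           (trans
             (length-filter-map-except NA? (g zero ,_) (upTo⁺ (h (g zero))) (∈-upTo⁺ (r<h zero))
               (λ na → proj₂ na refl) (λ y≢r → i∉g zero , y≢r ∘ sym))
             (length-upTo (h (g zero))))
           (nonAttackedCells (g ∘ suc) (i∉g ∘ suc) (r<h ∘ suc)) ⟩
    h (g zero) + sum (h ∘ g ∘ suc) ∎
    where
    open ≡-Reasoning
    NA?  = nonAttacking? (i , r)
    col  = column (g zero)
    rest = concatMap column (tabulate (g ∘ suc))
    shift : ∀ a b m → a + b + suc m ≡ suc a + (b + m)
    shift = solve-∀

-- The factor `n ∸ suc (toℕ i)` is the number of columns to the right of `i`; the truncated
-- subtraction is exact since `toℕ i < n`.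
weight : ∀ {n} → Fin n → ℕ → ℕ
weight {n} i b = b * (b + 2 * (n ∸ suc (toℕ i)))

-- Induction that removes the leftmost column. The map `g` selects the remaining columns, so cells
-- keep their indices in `Fin n` while `m` decreases; weights depend only on the number of columns
-- to the right and so survive the removal.
nonAttackingPairs : ∀ {n m} (h : Vector ℕ n) (g : Vector (Fin n) m) →
  Injective _≡_ _≡_ g → (∀ {k l} → k Fin.≤ l → h (g k) ≤ h (g l)) →
  2 * relatedPairs nonAttacking? (concatMap (column h) (tabulate g)) + sum (λ l → weight l (h (g l)))
    ≡ sum (h ∘ g) * sum (h ∘ g)
nonAttackingPairs {m = zero}  h g inj mono = refl
nonAttackingPairs {m = suc m} h g inj mono =
  combine _ b m _ _ _ first-column
    (nonAttackingPairs h (g ∘ suc) (Fin.suc-injective ∘ inj) (λ k≤l → mono (s≤s k≤l)))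
  where
  open ≡-Reasoning
  i = g zero
  b = h i
  rest = concatMap (column h) (tabulate (g ∘ suc))

  first-column : relatedPairs nonAttacking? (column h i ++ rest) + b * m
    ≡ b * sum (h ∘ g ∘ suc) + relatedPairs nonAttacking? rest
  first-column = subst
    (λ c → relatedPairs nonAttacking? (column h i ++ rest) + c * m
      ≡ c * sum (h ∘ g ∘ suc) + relatedPairs nonAttacking? rest)
    (trans (length-map (i ,_) (upTo b)) (length-upTo b))
    (relatedPairs-++ nonAttacking?
      (AllPairs.map⁺ (AllPairs.map (λ _ na → proj₁ na refl) (upTo⁺ b)))
      (All.map⁺ (All.map
        (λ r<b → nonAttackedCells h (g ∘ suc)
          (λ l gz≡gl → Fin.0≢1+n (inj gz≡gl))
          -- Weakly increasing heights enter here: a row met by the first column is met by every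
          -- later one.
          (λ l → <-≤-trans r<b (mono z≤n)))
        (All.all-upTo b))))

  -- The square of `b + s` is expanded: `p` and `q` count pairs with and without the first column,
  -- which has `b` cells; the `m` later columns have `s` cells and total weight `f`.
  combine : ∀ p b m s q f → p + b * m ≡ b * s + q → 2 * q + f ≡ s * s →
    2 * p + (b * (b + 2 * m) + f) ≡ (b + s) * (b + s)
  combine p b m s q f eq₁ eq₂ = begin
    2 * p + (b * (b + 2 * m) + f)    ≡⟨ collect p b m f ⟩
    b * b + 2 * (p + b * m) + f      ≡⟨ cong (λ t → b * b + 2 * t + f) eq₁ ⟩
    b * b + 2 * (b * s + q) + f      ≡⟨ regroup b s q f ⟩
    b * b + 2 * (b * s) + (2 * q + f) ≡⟨ cong (λ t → b * b + 2 * (b * s) + t) eq₂ ⟩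
    b * b + 2 * (b * s) + s * s      ≡⟨ square b s ⟩
    (b + s) * (b + s)                ∎
    where
    collect : ∀ p b m f → 2 * p + (b * (b + 2 * m) + f) ≡ b * b + 2 * (p + b * m) + f
    collect = solve-∀
    regroup : ∀ b s q f → b * b + 2 * (b * s + q) + f ≡ b * b + 2 * (b * s) + (2 * q + f)
    regroup = solve-∀
    square : ∀ b s → b * b + 2 * (b * s) + s * s ≡ (b + s) * (b + s)
    square = solve-∀

totalWeight : ∀ {n} → Vector ℕ n → ℕ
totalWeight h = sum (λ i → weight i (h i))

rookNumber₂ : ∀ {n} (B : FerrersBoard n) →
  2 * rookNumber B 2 + totalWeight (height B) ≡ sum (height B) * sum (height B)
rookNumber₂ B = trans
  (cong (λ r → 2 * r + totalWeight (height B)) (length-filter-choose₂ nonAttacking? (cells B)))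
  (nonAttackingPairs (height B) id id (increasing B))

-- Sums and weights under a move of cells

sum-differ₁ : ∀ {n} {s t : Vector ℕ n} i → (∀ l → l ≢ i → s l ≡ t l) →
  sum s + t i ≡ sum t + s i
sum-differ₁ {suc n} {s} {t} i s≗t = begin
  sum s + t i                     ≡⟨ cong (_+ t i) (sum-remove s) ⟩
  s i + sum (removeAt s i) + t i  ≡⟨ cong (λ r → s i + r + t i) (sum-cong-≗ λ l → s≗t (punchIn i l) (Fin.punchInᵢ≢i i l)) ⟩
  s i + sum (removeAt t i) + t i  ≡⟨ swap-ends (s i) _ (t i) ⟩
  t i + sum (removeAt t i) + s i  ≡⟨ cong (_+ s i) (sum-remove t) ⟨
  sum t + s i                     ∎
  where
  open ≡-Reasoning
  swap-ends : ∀ x y z → x + y + z ≡ z + y + x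
  swap-ends = solve-∀

-- The vector `u` changes `s` at `i` only, which splits the passage to `t` into two changes of one
-- entry. It serves both for heights and for weights.
sum-differ₂ : ∀ {n} {s t : Vector ℕ n} {i j} → i ≢ j → (∀ l → l ≢ i → l ≢ j → s l ≡ t l) →
  sum s + (t i + t j) ≡ sum t + (s i + s j)
sum-differ₂ {s = s} {t} {i} {j} i≢j s≗t = begin
  sum s + (t i + t j)   ≡⟨ +-assoc (sum s) _ _ ⟨
  sum s + t i + t j     ≡⟨ cong (λ x → sum s + x + t j) (updateAt-updates i s) ⟨
  sum s + u i + t j     ≡⟨ cong (_+ t j) (sum-differ₁ i (λ l l≢i → sym (updateAt-minimal l i s l≢i))) ⟩
  sum u + s i + t j     ≡⟨ swap-last (sum u) (s i) (t j) ⟩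
  sum u + t j + s i     ≡⟨ cong (_+ s i) (sum-differ₁ j u≗t) ⟩
  sum t + u j + s i     ≡⟨ cong (λ x → sum t + x + s i) (updateAt-minimal j i s (i≢j ∘ sym)) ⟩
  sum t + s j + s i     ≡⟨ trans (+-assoc (sum t) _ _) (cong (_+_ (sum t)) (+-comm (s j) (s i))) ⟩
  sum t + (s i + s j)   ∎
  where
  open ≡-Reasoning
  u = updateAt s i (const (t i))
  swap-last : ∀ x y z → x + y + z ≡ x + z + y
  swap-last = solve-∀
  u≗t : ∀ l → l ≢ j → u l ≡ t l
  u≗t l l≢j with l Fin.≟ i
  ... | yes refl = updateAt-updates i s
  ... | no l≢i   = trans (updateAt-minimal l i s l≢i) (s≗t l l≢i l≢j)

-- A move of k cells changes the heights c + k and d of two columns to c and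
-- d + k; these columns have I and J columns to their right.
weights-balance : ∀ {c d k I J} .{{_ : NonZero k}} →
  c * (c + 2 * I) + (d + k) * (d + k + 2 * J) ≡ (c + k) * (c + k + 2 * I) + d * (d + 2 * J) →
  d + J ≡ c + I
weights-balance {c} {d} {k} {I} {J} eq = *-cancelˡ-≡ _ _ k (*-cancelˡ-≡ _ _ 2 (+-cancelˡ-≡ common _ _ (begin
  common + 2 * (k * (d + J))                            ≡⟨ expandˡ c d k I J ⟩
  c * (c + 2 * I) + (d + k) * (d + k + 2 * J)           ≡⟨ eq ⟩
  (c + k) * (c + k + 2 * I) + d * (d + 2 * J)           ≡⟨ expandʳ c d k I J ⟩
  common + 2 * (k * (c + I))                            ∎)))
  where
  open ≡-Reasoning
  -- The part shared by both sides after expansion; what remains is linear in `k`.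
  common = c * (c + 2 * I) + d * (d + 2 * J) + k * k
  expandˡ : ∀ c d k I J → c * (c + 2 * I) + d * (d + 2 * J) + k * k + 2 * (k * (d + J))
    ≡ c * (c + 2 * I) + (d + k) * (d + k + 2 * J)
  expandˡ = solve-∀
  expandʳ : ∀ c d k I J → (c + k) * (c + k + 2 * I) + d * (d + 2 * J)
    ≡ c * (c + 2 * I) + d * (d + 2 * J) + k * k + 2 * (k * (c + I))
  expandʳ = solve-∀

-- From balanced weights to swapped root entries

+-≡⇒-≡ : ∀ a b c d → a + d ≡ c + b → + a ℤ.- + b ≡ + c ℤ.- + d
+-≡⇒-≡ a b c d eq = begin
  + a ℤ.- + b           ≡⟨ ℤ.m-n≡m⊖n a b ⟩
  a ℤ.⊖ b               ≡⟨ ℤ.+-cancelˡ-⊖ d a b ⟨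
  (d + a) ℤ.⊖ (d + b)   ≡⟨ cong₂ ℤ._⊖_ (trans (+-comm d a) (trans eq (+-comm c b))) (+-comm d b) ⟩
  (b + c) ℤ.⊖ (b + d)   ≡⟨ ℤ.+-cancelˡ-⊖ b c d ⟩
  c ℤ.⊖ d               ≡⟨ ℤ.m-n≡m⊖n c d ⟨
  + c ℤ.- + d           ∎
  where open ≡-Reasoning

-- This is `i - b₂ᵢ = j - b₁ⱼ` rearranged without subtraction.
move-balance : ∀ {n} (B₁ B₂ : FerrersBoard n) → rookNumber B₁ 2 ≡ rookNumber B₂ 2 →
  ∀ {i j k} → i ≢ j → 0 < k →
  height B₁ i ≡ height B₂ i + k → height B₁ j + k ≡ height B₂ j →
  (∀ l → l ≢ i → l ≢ j → height B₁ l ≡ height B₂ l) →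
  toℕ i + height B₁ j ≡ toℕ j + height B₂ i
move-balance {n} B₁ B₂ r₂≡ {i} {j} {k} i≢j 0<k at-i at-j elsewhere =
  -- The weights count columns from the right, the root vector from the left; adding `I + J`
  -- translates, as `toℕ i + I` and `toℕ j + J` both equal `pred n`.
  +-cancelʳ-≡ (I + J) _ _ (begin
    toℕ i + d + (I + J)    ≡⟨ regroup (toℕ i) d I J ⟩
    toℕ i + I + (d + J)    ≡⟨ cong₂ _+_ (trans (rightOf i) (sym (rightOf j))) d+J≡c+I ⟩
    toℕ j + J + (c + I)    ≡⟨ regroup′ (toℕ j) c I J ⟩
    toℕ j + c + (I + J)    ∎)
  where
  open ≡-Reasoning
  h₁ = height B₁
  h₂ = height B₂
  c  = h₂ i
  d  = h₁ j
  I  = n ∸ suc (toℕ i)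
  J  = n ∸ suc (toℕ j)

  rightOf : ∀ (l : Fin n) → toℕ l + (n ∸ suc (toℕ l)) ≡ pred n
  rightOf l = cong pred (m+[n∸m]≡n (Fin.toℕ<n l))

  regroup : ∀ a d I J → a + d + (I + J) ≡ a + I + (d + J)
  regroup = solve-∀
  regroup′ : ∀ b c I J → b + J + (c + I) ≡ b + c + (I + J)
  regroup′ = solve-∀
  move-total : ∀ c d k → c + (d + k) ≡ c + k + d
  move-total = solve-∀

  sums≡ : sum h₁ ≡ sum h₂
  sums≡ = +-cancelʳ-≡ (c + h₂ j) _ _ (begin
    sum h₁ + (c + h₂ j)    ≡⟨ sum-differ₂ i≢j elsewhere ⟩
    sum h₂ + (h₁ i + d)    ≡⟨ cong (λ x → sum h₂ + (x + d)) at-i ⟩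
    sum h₂ + (c + k + d)   ≡⟨ cong (_+_ (sum h₂)) (move-total c d k) ⟨
    sum h₂ + (c + (d + k)) ≡⟨ cong (λ x → sum h₂ + (c + x)) at-j ⟩
    sum h₂ + (c + h₂ j)    ∎)

  totalWeights≡ : totalWeight h₁ ≡ totalWeight h₂
  totalWeights≡ = +-cancelˡ-≡ (2 * rookNumber B₁ 2) _ _ (begin
    2 * rookNumber B₁ 2 + totalWeight h₁ ≡⟨ rookNumber₂ B₁ ⟩
    sum h₁ * sum h₁                      ≡⟨ cong₂ _*_ sums≡ sums≡ ⟩
    sum h₂ * sum h₂                      ≡⟨ rookNumber₂ B₂ ⟨
    2 * rookNumber B₂ 2 + totalWeight h₂ ≡⟨ cong (λ r → 2 * r + totalWeight h₂) r₂≡ ⟨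
    2 * rookNumber B₁ 2 + totalWeight h₂ ∎)

  d+J≡c+I : d + J ≡ c + I
  d+J≡c+I = weights-balance {c} {d} {k} {I} {J} {{>-nonZero 0<k}} (+-cancelˡ-≡ (totalWeight h₁) _ _ (begin
    totalWeight h₁ + (weight i c + weight j (d + k))
      ≡⟨ cong (λ x → totalWeight h₁ + (weight i c + weight j x)) at-j ⟩
    totalWeight h₁ + (weight i (h₂ i) + weight j (h₂ j))
      ≡⟨ sum-differ₂ i≢j (λ l l≢i l≢j → cong (weight l) (elsewhere l l≢i l≢j)) ⟩
    totalWeight h₂ + (weight i (h₁ i) + weight j d)
      ≡⟨ cong₂ (λ w x → w + (weight i x + weight j d)) (sym totalWeights≡) at-i ⟩
    totalWeight h₁ + (weight i (c + k) + weight j d) ∎))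

-- A move leaves its two columns unordered, while a swap lists them from left to right; the
-- conditions are symmetric in `i` and `j`.
differBySwap : ∀ {n} {z w : Vector ℤ n} {i j} → i ≢ j → z i ≢ z j →
  w i ≡ z j → w j ≡ z i → (∀ l → l ≢ i → l ≢ j → w l ≡ z l) →
  DifferBySwap z w
differBySwap {i = i} {j} i≢j zᵢ≢zⱼ wᵢ≡zⱼ wⱼ≡zᵢ elsewhere with Fin.<-cmp i j
... | tri< i<j _ _ = i , j , i<j , zᵢ≢zⱼ , wᵢ≡zⱼ , wⱼ≡zᵢ , elsewhere
... | tri≈ _ i≡j _ = contradiction i≡j i≢j
... | tri> _ _ j<i = j , i , j<i , zᵢ≢zⱼ ∘ sym , wⱼ≡zᵢ , wᵢ≡zⱼ , λ l l≢j l≢i → elsewhere l l≢i l≢j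

theorem6 : ∀ {m n : ℕ} (B : FerrersBoard m) (B₁ B₂ : FerrersBoard n) →
    RookEquivalent B₁ B₂ → Edge B B₁ B₂ →
    DifferBySwap (rootVector B₁) (rootVector B₂)
theorem6 B B₁ B₂ B₁≡B₂ edge with Edge.move edge
... | i , j , k , i≢j , 0<k , at-i , at-j , elsewhere =
  differBySwap i≢j zᵢ≢zⱼ wᵢ≡zⱼ wⱼ≡zᵢ
    (λ l l≢i l≢j → cong (λ b → + toℕ l ℤ.- + b) (sym (elsewhere l l≢i l≢j)))
  where
  open ≡-Reasoning

  balance : toℕ i + height B₁ j ≡ toℕ j + height B₂ i
  balance = move-balance B₁ B₂ (B₁≡B₂ 2) i≢j 0<k at-i at-j elsewhere

  wᵢ≡zⱼ : rootVector B₂ i ≡ rootVector B₁ j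
  wᵢ≡zⱼ = +-≡⇒-≡ (toℕ i) (height B₂ i) (toℕ j) (height B₁ j) balance

  -- Adding `k` to both sides of `balance` turns `height B₂ i` into `height B₁ i` and `height B₁ j`
  -- into `height B₂ j`.
  wⱼ≡zᵢ : rootVector B₂ j ≡ rootVector B₁ i
  wⱼ≡zᵢ = +-≡⇒-≡ (toℕ j) (height B₂ j) (toℕ i) (height B₁ i) (begin
    toℕ j + height B₁ i         ≡⟨ cong (_+_ (toℕ j)) at-i ⟩
    toℕ j + (height B₂ i + k)   ≡⟨ +-assoc (toℕ j) _ k ⟨
    toℕ j + height B₂ i + k     ≡⟨ cong (_+ k) balance ⟨
    toℕ i + height B₁ j + k     ≡⟨ +-assoc (toℕ i) _ k ⟩
    toℕ i + (height B₁ j + k)   ≡⟨ cong (_+_ (toℕ i)) at-j ⟩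
    toℕ i + height B₂ j         ∎)

  -- Equal entries would leave entry `i` unchanged by the swap, hence also the height of column `i`,
  -- contrary to `0 < k`.
  zᵢ≢zⱼ : rootVector B₁ i ≢ rootVector B₁ j
  zᵢ≢zⱼ zᵢ≡zⱼ = <⇒≢ (m<m+n (height B₂ i) 0<k) (trans
    (ℤ.+-injective (ℤ.neg-injective (∙-cancelˡ (+ toℕ i) _ _ (trans wᵢ≡zⱼ (sym zᵢ≡zⱼ)))))
    at-i)
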